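{- There exist (i) an $\mathit{LTL}^{\bigcirc}_{\mathit{horn}}$ ontology-mediated atomic query (OMAQ), and (ii) an $\mathit{LTL}^{\Box}_{\mathit{krom}}$ and an $\mathit{LTL}^{\bigcirc}_{\mathit{krom}}$ ontology-mediated positive instance query (OMPIQ), for each of which the answering problem is $\mathrm{NC}^1$-hard for data complexity.
   Context: Fix a countably infinite set of atomic concepts. Temporal concepts (LTL-formulas) are given by $\varkappa::=\top\mid A_i\mid\neg\varkappa\mid\varkappa_1\land\varkappa_2\mid\varkappa_1\lor\varkappa_2\mid\bigcirc_F\varkappa\mid\Diamond_F\varkappa\mid\Box_F\varkappa\mid\varkappa_1\,\mathcal U\,\varkappa_2\mid\bigcirc_P\varkappa\mid\Diamond_P\varkappa\mid\Box_P\varkappa\mid\varkappa_1\,\mathcal S\,\varkappa_2$; a positive temporal concept is one without $\neg$. An interpretation $\mathfrak M$ assigns to each atomic concept $A$ a set $A^{\mathfrak M}\subseteq\mathbb Z$. Extensions: $\top^{\mathfrak M}=\mathbb Z$, Booleans set-theoretically, $(\bigcirc_F\varkappa)^{\mathfrak M}=\{n\mid n+1\in\varkappa^{\mathfrak M}\}$, $(\Box_F\varkappa)^{\mathfrak M}=\{n\mid k\in\varkappa^{\mathfrak M}\ \forall k>n\}$, $(\Diamond_F\varkappa)^{\mathfrak M}=\{n\mid\exists k>n,\ k\in\varkappa^{\mathfrak M}\}$, $(\varkappa_1\,\mathcal U\,\varkappa_2)^{\mathfrak M}=\{n\mid\exists k>n,\ k\in\varkappa_2^{\mathfrak M}\text{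 and }m\in\varkappa_1^{\mathfrak M}\text{ for all }n<m<k\}$, and symmetrically for the past operators. An ontology $\mathcal O$ is a finite set of clauses $C_1\land\dots\land C_k\to C_{k+1}\lor\dots\lor C_{k+m}$, $k,m\ge0$ (empty $\land$ is $\top$, empty $\lor$ is $\bot$), where each $C_i$ is an atomic concept prefixed by a sequence of operators from $\Box_F,\Box_P,\bigcirc_F,\bigcirc_P$. It is an $\mathit{LTL}^{\boldsymbol o}_{\boldsymbol c}$ ontology, $\boldsymbol o\in\{\Box,\bigcirc\}$, if only the (future and past) operators of the kind $\boldsymbol o$ occur in it and every clause satisfies $m\le1$ when $\boldsymbol c=\mathit{horn}$, and $k+m\le2$ when $\boldsymbol c=\mathit{krom}$. A clause is true in $\mathfrak M$ if $\bigcap_{i\le k}C_i^{\mathfrak M}\subseteq\bigcup_{j=1}^{m}C_{k+j}^{\mathfrak M}$ (empty $\bigcap$ is $\mathbb Z$, empty $\bigcup$ is $\emptyset$). An $\mathit{LTL}^{\boldsymbol o}_{\boldsymbol c}$ OMPIQ is a pair $\boldsymbol q=(\mathcal O,\varkappa)$ with an $\mathit{LTL}^{\boldsymbol o}_{\boldsymbol c}$ ontology $\mathcal O$ and a positive temporal concept $\varkappa$ (which may use arbitrary temporal operators); it is an OMAQ if $\varkappa$ is an atomic concept. A data instance $\mathcal A$ is a finite set of ground atoms $A_i(\ell)$, $\ell\in\mathbb Z$; it is assumed throughout that the least integer $\min\mathcal A$ occurring in it is $0$ and the greatest one satisfies $\max\mathcal A\ge1$; $\mathrm{tem}(\mathcal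 A)=\{n\in\mathbb Z\mid\min\mathcal A\le n\le\max\mathcal A\}$. $\mathfrak M$ is a model of $(\mathcal O,\mathcal A)$ if all clauses of $\mathcal O$ are true in $\mathfrak M$ and $\ell\in A^{\mathfrak M}$ for all $A(\ell)\in\mathcal A$. $\mathrm{ans}(\boldsymbol q,\mathcal A)=\{\ell\in\mathrm{tem}(\mathcal A)\mid\ell\in\varkappa^{\mathfrak M}\text{ for every model }\mathfrak M\text{ of }(\mathcal O,\mathcal A)\}$. The answering problem for $\boldsymbol q$ in data complexity: $\boldsymbol q$ is fixed; given a data instance $\mathcal A$ (timestamps in unary) and $\ell\in\mathrm{tem}(\mathcal A)$, decide whether $\ell\in\mathrm{ans}(\boldsymbol q,\mathcal A)$. $\mathrm{NC}^1$-hardness is understood with respect to the usual reductions for this class (e.g. $\mathrm{AC}^0$ many-one reductions). -}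

module Defs where

open import Data.Bool.Base using (Bool; true; false)
import Data.Bool.Base as Bool
open import Data.Bool.ListAction using (all; any)
open import Data.Integer.Base using (ℤ; 0ℤ; 1ℤ; _+_; _-_; _≤_; _<_; ∣_∣)
open import Data.List.Base using (List; _++_; [_]; length; map; replicate; concatMap; foldr)
open import Data.List.Membership.Propositional using () renaming (_∈_ to _∈ₗ_)
open import Data.List.Relation.Unary.All using (All)
open import Data.List.Relation.Unary.Any using (Any)
open import Data.Fin.Base using (Fin)
open import Data.Nat.Base as ℕ using (ℕ; suc; _⊔_; _^_)
open import Data.Nat.Logarithm using (⌈log₂_⌉)
open import Data.Product.Base using (∃-syntax; _×_; _,_; proj₁; proj₂)
open import Data.Sum.Base using (_⊎_)
open import Data.Unit.Base using (⊤)
open import Data.Vec.Base as Vec using (Vec)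
open import Function.Bundles using (_⇔_)
open import Level using (Level; 0ℓ) renaming (suc to lsuc; _⊔_ to _⊔ˡ_)
open import Relation.Binary.PropositionalEquality using (_≡_)
open import Relation.Nullary.Negation.Core using (¬_)
open import Relation.Unary using (Pred; _∈_)

------------------------------------------------------------------------
-- Temporal concepts

AtomicConcept : Set
AtomicConcept = ℕ

infixr 7 _`∧_
infixr 6 _`∨_
infix  8 _𝒰_ _𝒮_

data TemporalConcept : Set where
  `⊤            : TemporalConcept
  atom          : AtomicConcept → TemporalConcept
  `¬_           : TemporalConcept → TemporalConcept
  _`∧_ _`∨_     : TemporalConcept → TemporalConcept → TemporalConcept
  ○F_ ◇F_ □F_   : TemporalConcept → TemporalConcept
  _𝒰_           : TemporalConcept → TemporalConcept → TemporalConcept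
  ○P_ ◇P_ □P_   : TemporalConcept → TemporalConcept
  _𝒮_           : TemporalConcept → TemporalConcept → TemporalConcept

data Positive : TemporalConcept → Set where
  `⊤    : Positive `⊤
  atom  : ∀ A → Positive (atom A)
  _`∧_  : ∀ {ϰ₁ ϰ₂} → Positive ϰ₁ → Positive ϰ₂ → Positive (ϰ₁ `∧ ϰ₂)
  _`∨_  : ∀ {ϰ₁ ϰ₂} → Positive ϰ₁ → Positive ϰ₂ → Positive (ϰ₁ `∨ ϰ₂)
  ○F_   : ∀ {ϰ} → Positive ϰ → Positive (○F ϰ)
  ◇F_   : ∀ {ϰ} → Positive ϰ → Positive (◇F ϰ)
  □F_   : ∀ {ϰ} → Positive ϰ → Positive (□F ϰ)
  _𝒰_   : ∀ {ϰ₁ ϰ₂} → Positive ϰ₁ → Positive ϰ₂ → Positive (ϰ₁ 𝒰 ϰ₂)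
  ○P_   : ∀ {ϰ} → Positive ϰ → Positive (○P ϰ)
  ◇P_   : ∀ {ϰ} → Positive ϰ → Positive (◇P ϰ)
  □P_   : ∀ {ϰ} → Positive ϰ → Positive (□P ϰ)
  _𝒮_   : ∀ {ϰ₁ ϰ₂} → Positive ϰ₁ → Positive ϰ₂ → Positive (ϰ₁ 𝒮 ϰ₂)

Interpretation : Set₁
Interpretation = AtomicConcept → Pred ℤ 0ℓ

-- All of ◇, □, 𝒰, 𝒮 are strict: they do not look at the current instant.
⟦_⟧ : TemporalConcept → Interpretation → Pred ℤ 0ℓ
⟦ `⊤ ⟧       𝔐 n = ⊤
⟦ atom A ⟧   𝔐 n = n ∈ 𝔐 A
⟦ `¬ ϰ ⟧     𝔐 n = ¬ (n ∈ ⟦ ϰ ⟧ 𝔐)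
⟦ ϰ₁ `∧ ϰ₂ ⟧ 𝔐 n = n ∈ ⟦ ϰ₁ ⟧ 𝔐 × n ∈ ⟦ ϰ₂ ⟧ 𝔐
⟦ ϰ₁ `∨ ϰ₂ ⟧ 𝔐 n = n ∈ ⟦ ϰ₁ ⟧ 𝔐 ⊎ n ∈ ⟦ ϰ₂ ⟧ 𝔐
⟦ ○F ϰ ⟧     𝔐 n = (n + 1ℤ) ∈ ⟦ ϰ ⟧ 𝔐
⟦ ◇F ϰ ⟧     𝔐 n = ∃[ k ] n < k × k ∈ ⟦ ϰ ⟧ 𝔐
⟦ □F ϰ ⟧     𝔐 n = ∀ k → n < k → k ∈ ⟦ ϰ ⟧ 𝔐
⟦ ϰ₁ 𝒰 ϰ₂ ⟧  𝔐 n = ∃[ k ] n < k × k ∈ ⟦ ϰ₂ ⟧ 𝔐 × (∀ m → n < m → m < k → m ∈ ⟦ ϰ₁ ⟧ 𝔐)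
⟦ ○P ϰ ⟧     𝔐 n = (n - 1ℤ) ∈ ⟦ ϰ ⟧ 𝔐
⟦ ◇P ϰ ⟧     𝔐 n = ∃[ k ] k < n × k ∈ ⟦ ϰ ⟧ 𝔐
⟦ □P ϰ ⟧     𝔐 n = ∀ k → k < n → k ∈ ⟦ ϰ ⟧ 𝔐
⟦ ϰ₁ 𝒮 ϰ₂ ⟧  𝔐 n = ∃[ k ] k < n × k ∈ ⟦ ϰ₂ ⟧ 𝔐 × (∀ m → k < m → m < n → m ∈ ⟦ ϰ₁ ⟧ 𝔐)

------------------------------------------------------------------------
-- Ontologies

data OpKind : Set where
  □ ○ : OpKind

data Direction : Set where
  future past : Direction

PrefixOp : Set
PrefixOp = OpKind × Direction

applyOp : PrefixOp → TemporalConcept → TemporalConcept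
applyOp (□ , future) ϰ = □F ϰ
applyOp (□ , past)   ϰ = □P ϰ
applyOp (○ , future) ϰ = ○F ϰ
applyOp (○ , past)   ϰ = ○P ϰ

record PrefixedAtom : Set where
  constructor _·_
  field
    prefix : List PrefixOp
    base   : AtomicConcept

  concept : TemporalConcept
  concept = foldr applyOp (atom base) prefix

open PrefixedAtom public using (prefix; base)

-- body ⟶ head stands for  C₁ ∧ … ∧ Cₖ → Cₖ₊₁ ∨ … ∨ Cₖ₊ₘ.
record Clause : Set where
  constructor _⟶_
  field
    body head : List PrefixedAtom

open Clause public

Ontology : Set
Ontology = List Clause

data ClauseKind : Set where
  horn krom : ClauseKind

UsesOnly : OpKind → PrefixedAtom → Set
UsesOnly o C = All (λ op → proj₁ op ≡ o) (prefix C)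

HasShape : ClauseKind → Clause → Set
HasShape horn c = length (head c) ℕ.≤ 1
HasShape krom c = length (body c) ℕ.+ length (head c) ℕ.≤ 2

record IsLTL (o : OpKind) (c : ClauseKind) (𝒪 : Ontology) : Set where
  field
    operators : All (λ cl → All (UsesOnly o) (body cl) × All (UsesOnly o) (head cl)) 𝒪
    shape     : All (HasShape c) 𝒪

TrueIn : Interpretation → Clause → Set
TrueIn 𝔐 cl = ∀ n → All (holdsAt n) (body cl) → Any (holdsAt n) (head cl)
  where
  holdsAt : ℤ → PrefixedAtom → Set
  holdsAt n C = n ∈ ⟦ PrefixedAtom.concept C ⟧ 𝔐

------------------------------------------------------------------------
-- Data instances and queries

GroundAtom : Set
GroundAtom = AtomicConcept × ℤ

IsLeast IsGreatest : ℤ → List ℤ → Set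
IsLeast    k ks = k ∈ₗ ks × All (k ≤_) ks
IsGreatest k ks = k ∈ₗ ks × All (_≤ k) ks

-- The list enumerates a finite set: order and repetitions carry no meaning.
record DataInstance : Set where
  field
    atoms : List GroundAtom

  timestamps : List ℤ
  timestamps = map proj₂ atoms

  field
    min-is-0 : IsLeast 0ℤ timestamps
    max      : ℤ
    max-is   : IsGreatest max timestamps
    1≤max    : 1ℤ ≤ max

  tem : Pred ℤ 0ℓ
  tem n = 0ℤ ≤ n × n ≤ max

open DataInstance public using (atoms; tem)

record IsModel (𝔐 : Interpretation) (𝒪 : Ontology) (𝒜 : DataInstance) : Set where
  field
    clauses : All (TrueIn 𝔐) 𝒪
    facts   : All (λ (A , ℓ) → ℓ ∈ 𝔐 A) (atoms 𝒜)

record OMPIQ (o : OpKind) (c : ClauseKind) : Set where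
  field
    ontology : Ontology
    inLTL    : IsLTL o c ontology
    concept  : TemporalConcept
    positive : Positive concept

IsOMAQ : ∀ {o c} → OMPIQ o c → Set
IsOMAQ q = ∃[ A ] OMPIQ.concept q ≡ atom A

ans : ∀ {o c} → OMPIQ o c → DataInstance → Pred ℤ (lsuc 0ℓ)
ans q 𝒜 ℓ =
  ℓ ∈ tem 𝒜 × (∀ 𝔐 → IsModel 𝔐 (OMPIQ.ontology q) 𝒜 → ℓ ∈ ⟦ OMPIQ.concept q ⟧ 𝔐)

------------------------------------------------------------------------
-- The answering problem as a language

Language : (ℓ : Level) → Set (lsuc ℓ)
Language ℓ = Pred (List Bool) ℓ

unary : ℕ → List Bool
unary n = replicate n true ++ [ false ]

-- Timestamps in tem 𝒜 are non-negative, so taking absolute values loses nothing.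
encode : DataInstance → ℤ → List Bool
encode 𝒜 ℓ = unary ∣ ℓ ∣ ++ concatMap (λ (A , k) → unary A ++ unary ∣ k ∣) (atoms 𝒜)

Answering : ∀ {o c} → OMPIQ o c → Language (lsuc 0ℓ)
Answering q w = ∃[ 𝒜 ] ∃[ ℓ ] w ≡ encode 𝒜 ℓ × ℓ ∈ ans q 𝒜

------------------------------------------------------------------------
-- Boolean circuits

data Gate (w : ℕ) : Set where
  NOT    : Fin w → Gate w
  AND OR : List (Fin w) → Gate w

-- Wiring n w is an acyclic graph with n input nodes and w nodes in total.
-- Nodes are numbered from the most recently added one, which has index zero.
data Wiring (n : ℕ) : ℕ → Set where
  inputs : Wiring n n
  _▷_    : ∀ {w} → Wiring n w → Gate w → Wiring n (suc w)

predecessors : ∀ {w} → Gate w → List (Fin w)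
predecessors (NOT i)  = [ i ]
predecessors (AND is) = is
predecessors (OR is)  = is

evalGate : ∀ {w} → Vec Bool w → Gate w → Bool
evalGate v (NOT i)  = Bool.not (Vec.lookup v i)
evalGate v (AND is) = all (Vec.lookup v) is
evalGate v (OR is)  = any (Vec.lookup v) is

values : ∀ {n w} → Wiring n w → Vec Bool n → Vec Bool w
values inputs  x = x
values (W ▷ g) x = evalGate (values W x) g Vec.∷ values W x

nodeDepths : ∀ {n w} → Wiring n w → Vec ℕ w
nodeDepths {n} inputs = Vec.replicate n 0
nodeDepths (W ▷ g)    =
  suc (foldr _⊔_ 0 (map (Vec.lookup (nodeDepths W)) (predecessors g))) Vec.∷ nodeDepths W

maxFanIn : ∀ {n w} → Wiring n w → ℕ
maxFanIn inputs  = 0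
maxFanIn (W ▷ g) = length (predecessors g) ⊔ maxFanIn W

record Circuit (n m : ℕ) : Set where
  field
    {nodes} : ℕ
    wiring  : Wiring n nodes
    outputs : Vec (Fin nodes) m

open Circuit public

run : ∀ {n m} → Circuit n m → Vec Bool n → Vec Bool m
run C x = Vec.map (Vec.lookup (values (wiring C) x)) (outputs C)

depth : ∀ {n m} → Circuit n m → ℕ
depth C = Vec.foldr′ _⊔_ 0 (nodeDepths (wiring C))

-- Outputs count, since several of them may be attached to the same node.
size : ∀ {n m} → Circuit n m → ℕ
size {m = m} C = nodes C ℕ.+ m

fanIn : ∀ {n m} → Circuit n m → ℕ
fanIn C = maxFanIn (wiring C)

PolynomiallyBounded LogarithmicallyBounded Bounded : (ℕ → ℕ) → Set
PolynomiallyBounded    f = ∃[ c ] ∀ n → f n ℕ.≤ n ^ c ℕ.+ c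
LogarithmicallyBounded f = ∃[ c ] ∀ n → f n ℕ.≤ c ℕ.* ⌈log₂ n ⌉ ℕ.+ c
Bounded                f = ∃[ c ] ∀ n → f n ℕ.≤ c

------------------------------------------------------------------------
-- NC¹ and AC⁰ many-one reductions, both non-uniform

record NC¹ {ℓ} (L : Language ℓ) : Set ℓ where
  field
    circuit  : (n : ℕ) → Circuit n 1
    fanIn≤2  : ∀ n → fanIn (circuit n) ℕ.≤ 2
    polySize : PolynomiallyBounded (λ n → size (circuit n))
    logDepth : LogarithmicallyBounded (λ n → depth (circuit n))
    decides  : ∀ {n} (x : Vec Bool n) →
               Vec.toList x ∈ L ⇔ Vec.head (run (circuit n) x) ≡ true

infix 4 _≤AC⁰_

record _≤AC⁰_ {ℓ ℓ′} (L : Language ℓ) (L′ : Language ℓ′) : Set (ℓ ⊔ˡ ℓ′) where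
  field
    outLength  : ℕ → ℕ
    circuit    : (n : ℕ) → Circuit n (outLength n)
    polySize   : PolynomiallyBounded (λ n → size (circuit n))
    constDepth : Bounded (λ n → depth (circuit n))
    reduces    : ∀ {n} (x : Vec Bool n) →
                 Vec.toList x ∈ L ⇔ Vec.toList (run (circuit n) x) ∈ L′

-- Every language in NC¹ is decidable, so quantifying over one universe level
-- of predicates already covers them all.
NC¹-Hard : ∀ {ℓ} → Language ℓ → Set (lsuc 0ℓ ⊔ˡ ℓ)
NC¹-Hard L′ = (L : Language 0ℓ) → NC¹ L → L ≤AC⁰ L′

{-# OPTIONS --safe #-}
module Submission where

-- By Barrington's theorem a circuit of depth d unfolds into a program of length ≤ 9 ^ (4 * d) over
-- permutations of five points, whose product moves 0 to 1 exactly when the circuit outputs true.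
-- The program is written down as a data instance, one instruction per instant, each output bit
-- being a constant, an input or a negated input. The automaton that multiplies the permutations
-- is fixed. Horn clauses with ○F simulate it directly. A krom ontology only lets every model guess,
-- for each state and instant, whether the automaton is in that state, and the positive concept
-- asks for an accepting end or for a violated transition; no temporal operator occurs in that
-- ontology, so it serves for both □ and ○.

open import Defs
open import Data.Bool.Base using (Bool; true; false; not; if_then_else_; _∧_; _∨_)
open import Data.Bool.ListAction using (all; any)
open import Data.Bool.Properties using (not-involutive; ∧-identityʳ)
open import Data.Empty using (⊥)
open import Data.Fin.Base using (Fin; zero; suc; toℕ; _↑ˡ_; _↑ʳ_; join; splitAt)
open import Data.Fin.Patterns
import Data.Fin.Properties as Fin
open import Data.Integer.Base as ℤ using (ℤ; +_; -[1+_]; 0ℤ; 1ℤ; ∣_∣; +≤+; +<+)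
import Data.Integer.Properties as ℤ
open import Data.List.Base as List using (List; []; _∷_; _++_; [_]; foldl; foldr; length; map)
open import Data.List.Properties using
  (foldl-++; map-++; map-∘; map-id; length-++; length-map; ++-assoc; ∷-injectiveʳ; take-all)
open import Data.List.Membership.Propositional using () renaming (_∈_ to _∈ₗ_)
open import Data.List.Membership.Propositional.Properties using (∈-cartesianProductWith⁺; ∈-map⁺; ∈-allFin)
open import Data.List.Relation.Unary.Any using (here; there)
import Data.List.Relation.Unary.All.Properties as All
open import Data.List.Relation.Unary.All as All using (All; []; _∷_)
open import Data.Nat.Base as ℕ using (ℕ; zero; suc; _+_; _*_; _^_; _≤_; _⊔_; z≤n; s≤s)
import Data.Nat.Properties as ℕ
open import Data.Nat.Logarithm using (⌈log₂_⌉; ⌈log₂⌉-mono-≤; ⌈log₂2^n⌉≡n)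
open import Data.Nat.Tactic.RingSolver using (solve-∀)
open import Data.Product.Base using (Σ; ∃-syntax; _×_; _,_; proj₁; proj₂)
open import Data.Maybe.Base using (just)
open import Data.Sum.Base as Sum using (_⊎_; inj₁; inj₂; [_,_]′)
open import Data.Vec.Base as Vec using (Vec; _∷_; [])
import Data.Vec.Properties as Vec
open import Relation.Binary.PropositionalEquality hiding ([_])
open import Function.Base using (id)
open import Function.Bundles using (_⇔_; mk⇔; Equivalence)
open import Relation.Unary using (_∈_)
open import Relation.Nullary.Decidable using (toWitness; yes; no)
open import Relation.Nullary.Negation using (¬_; contradiction)
open import Data.Unit.Base using (tt)

-- Permutation words and programs over five points

Letter State : Set
Letter = Fin 5
State  = Fin 5

-- Letters 0F and 1F are the identity and the 5-cycle that encode truth values; 2F, 3F and 4F are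
-- even permutations σ, τ, υ for which στυστ is that 5-cycle and nand-permutations holds.
table : Letter → Vec State 5
table 0F = 0F ∷ 1F ∷ 2F ∷ 3F ∷ 4F ∷ []
table 1F = 1F ∷ 2F ∷ 3F ∷ 4F ∷ 0F ∷ []
table 2F = 1F ∷ 2F ∷ 0F ∷ 3F ∷ 4F ∷ []
table 3F = 0F ∷ 1F ∷ 3F ∷ 4F ∷ 2F ∷ []
table 4F = 1F ∷ 0F ∷ 2F ∷ 4F ∷ 3F ∷ []

step : State → Letter → State
step s a = Vec.lookup (table a) s

bit : Bool → Letter
bit b = if b then 1F else 0F

data Instruction (n : ℕ) : Set where
  const : Letter → Instruction n
  test  : Fin n → Instruction n

Program : ℕ → Set
Program n = List (Instruction n)

read : ∀ {n} → Vec Bool n → Instruction n → Letter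
read x (const a) = a
read x (test i)  = bit (Vec.lookup x i)

word : ∀ {n} → Program n → Vec Bool n → List Letter
word P x = map (read x) P

-- All states matter, not only the start, because a composite program enters its parts in any state.
-- The record wrapper keeps `P` and `f` inferable.
record Computes {n} (P : Program n) (f : Vec Bool n → Bool) : Set where
  constructor computing
  field
    action : ∀ x s → foldl step s (word P x) ≡ step s (bit (f x))

open Computes

-- This takes the place of the commutator in Barrington's argument: each argument again occurs
-- twice, but the constants are chosen so that the value appears on the same 5-cycle as the
-- arguments. No change of cycle is needed between levels.
nandₚ : ∀ {n} → Program n → Program n → Program n
nandₚ P Q =
  const 2F ∷ P ++ const 3F ∷ Q ++ const 4F ∷ P ++ const 2F ∷ Q ++ const 3F ∷ []

-- Once both bits are fixed, an equation between two maps on five points remains, and evaluation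
-- decides it.
nand-permutations : ∀ p q s →
  step (step (step (step (step (step (step (step (step s
    2F) (bit p)) 3F) (bit q)) 4F) (bit p)) 2F) (bit q)) 3F ≡ step s (bit (not (p ∧ q)))
nand-permutations true  true  = toWitness {a? = Fin.all? λ s → _ Fin.≟ _} tt
nand-permutations true  false = toWitness {a? = Fin.all? λ s → _ Fin.≟ _} tt
nand-permutations false true  = toWitness {a? = Fin.all? λ s → _ Fin.≟ _} tt
nand-permutations false false = toWitness {a? = Fin.all? λ s → _ Fin.≟ _} tt

-- Compiling circuits into programs

module _ {n : ℕ} where

  -- The arbitrary continuation `Q` lets `nand-computes` peel off its four subprograms one after
  -- another; the constants between them reduce by computation.
  Computes-++ : ∀ {P : Program n} {f} → Computes P f → ∀ Q x s →
                foldl step s (word (P ++ Q) x) ≡ foldl step (step s (bit (f x))) (word Q x)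
  Computes-++ {P} P-f Q x s
    rewrite map-++ (read x) P Q
          | foldl-++ step s (word P x) (word Q x)
          | action P-f x s = refl

  nand-computes : ∀ {P Q : Program n} {f g} → Computes P f → Computes Q g →
                  Computes (nandₚ P Q) (λ x → not (f x ∧ g x))
  nand-computes {f = f} {g} P-f Q-g = computing λ x s →
    trans (Computes-++ P-f _ x _)
      (trans (Computes-++ Q-g _ x _)
        (trans (Computes-++ P-f _ x _)
          (trans (Computes-++ Q-g _ x _)
            (nand-permutations (f x) (g x) s))))

  trueₚ falseₚ : Program n
  trueₚ  = [ const 1F ]
  falseₚ = [ const 0F ]

  notₚ : Program n → Program n
  notₚ P = nandₚ P trueₚ

  andₚ orₚ : Program n → Program n → Program n
  andₚ P Q = notₚ (nandₚ P Q)
  orₚ  P Q = nandₚ (notₚ P) (notₚ Q)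

  Computes-cong : ∀ {P : Program n} {f g} → (∀ x → f x ≡ g x) → Computes P f → Computes P g
  Computes-cong f≗g P-f = computing λ x s →
    trans (action P-f x s) (cong (λ b → step s (bit b)) (f≗g x))

  true-computes : Computes trueₚ (λ _ → true)
  true-computes = computing λ _ _ → refl

  not-computes : ∀ {P : Program n} {f} → Computes P f → Computes (notₚ P) (λ x → not (f x))
  not-computes {f = f} P-f =
    Computes-cong (λ x → cong not (∧-identityʳ (f x)))
      (nand-computes P-f true-computes)

  and-computes : ∀ {P Q : Program n} {f g} → Computes P f → Computes Q g →
                 Computes (andₚ P Q) (λ x → f x ∧ g x)
  and-computes P-f Q-g =
    Computes-cong (λ x → not-involutive _) (not-computes (nand-computes P-f Q-g))

  or-computes : ∀ {P Q : Program n} {f g} → Computes P f → Computes Q g →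
                Computes (orₚ P Q) (λ x → f x ∨ g x)
  or-computes {f = f} {g} P-f Q-g =
    Computes-cong (λ x → deMorgan (f x) (g x))
      (nand-computes (not-computes P-f) (not-computes Q-g))
    where
    deMorgan : ∀ b c → not (not b ∧ not c) ≡ b ∨ c
    deMorgan true  c = refl
    deMorgan false c = not-involutive c

  gateₚ : ∀ {w} → Gate w → (Fin w → Program n) → Program n
  gateₚ (NOT i)  Ps = notₚ (Ps i)
  gateₚ (AND is) Ps = foldr andₚ trueₚ (map Ps is)
  gateₚ (OR is)  Ps = foldr orₚ falseₚ (map Ps is)

  -- A shared node is compiled anew at each use, so the wiring unfolds into a formula. Depth and
  -- fan-in, not size, then control the length.
  compile : ∀ {w} → Wiring n w → Fin w → Program n
  compile inputs  i       = [ test i ]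
  compile (W ▷ g) zero    = gateₚ g (compile W)
  compile (W ▷ g) (suc i) = compile W i

  module _ {w} {Ps : Fin w → Program n} {v : Vec Bool n → Vec Bool w}
           (Ps-v : ∀ i → Computes (Ps i) (λ x → Vec.lookup (v x) i)) where

    all-computes : ∀ is → Computes (foldr andₚ trueₚ (map Ps is)) (λ x → all (Vec.lookup (v x)) is)
    all-computes []       = true-computes
    all-computes (i ∷ is) = and-computes (Ps-v i) (all-computes is)

    any-computes : ∀ is → Computes (foldr orₚ falseₚ (map Ps is)) (λ x → any (Vec.lookup (v x)) is)
    any-computes []       = computing λ _ _ → refl
    any-computes (i ∷ is) = or-computes (Ps-v i) (any-computes is)

    gate-computes : ∀ g → Computes (gateₚ g Ps) (λ x → evalGate (v x) g)
    gate-computes (NOT i)  = not-computes (Ps-v i)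
    gate-computes (AND is) = all-computes is
    gate-computes (OR is)  = any-computes is

  compile-computes : ∀ {w} (W : Wiring n w) i →
                     Computes (compile W i) (λ x → Vec.lookup (values W x) i)
  compile-computes inputs  i       = computing λ _ _ → refl
  compile-computes (W ▷ g) zero    = gate-computes (compile-computes W) g
  compile-computes (W ▷ g) (suc i) = compile-computes W i

  -- Length of compiled programs

  record Short (k : ℕ) (P : Program n) : Set where
    constructor short
    field
      length≤ : length P ≤ 9 ^ k

  open Short

  Short-mono : ∀ {k l P} → k ≤ l → Short k P → Short l P
  Short-mono k≤l (short P≤) = short (ℕ.≤-trans P≤ (ℕ.^-monoʳ-≤ 9 k≤l))

  1≤9^ : ∀ k → 1 ≤ 9 ^ k
  1≤9^ k = ℕ.^-monoʳ-≤ 9 (z≤n {k})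

  singleton-short : ∀ k i → Short k [ i ]
  singleton-short k i = short (1≤9^ k)

  nand-length : ∀ (P Q : Program n) →
                length (nandₚ P Q) ≡ 5 + 2 * length P + 2 * length Q
  nand-length P Q
    rewrite length-++ P {const 3F ∷ Q ++ const 4F ∷ P ++ const 2F ∷ Q ++ const 3F ∷ []}
          | length-++ Q {const 4F ∷ P ++ const 2F ∷ Q ++ const 3F ∷ []}
          | length-++ P {const 2F ∷ Q ++ const 3F ∷ []}
          | length-++ Q {const 3F ∷ []} = arithmetic (length P) (length Q)
    where
    arithmetic : ∀ p q → suc (p + suc (q + suc (p + suc (q + 1)))) ≡ 5 + 2 * p + 2 * q
    arithmetic = solve-∀

  -- The base 9 comes from here: five constants and two copies of each argument make nine pieces,
  -- each of length at most `9 ^ k`.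
  nand-short : ∀ {k P Q} → Short k P → Short k Q → Short (suc k) (nandₚ P Q)
  nand-short {k} {P} {Q} (short P≤) (short Q≤) = short (begin
    length (nandₚ P Q)                   ≡⟨ nand-length P Q ⟩
    5 + 2 * length P + 2 * length Q      ≤⟨ ℕ.+-mono-≤ (ℕ.+-mono-≤ (ℕ.*-monoʳ-≤ 5 (1≤9^ k)) (ℕ.*-monoʳ-≤ 2 P≤))
                                                         (ℕ.*-monoʳ-≤ 2 Q≤) ⟩
    5 * 9 ^ k + 2 * 9 ^ k + 2 * 9 ^ k    ≡⟨ arithmetic (9 ^ k) ⟩
    9 ^ suc k                            ∎)
    where
    open ℕ.≤-Reasoning
    arithmetic : ∀ m → 5 * m + 2 * m + 2 * m ≡ 9 * m
    arithmetic = solve-∀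

  not-short : ∀ {k P} → Short k P → Short (suc k) (notₚ P)
  not-short {k} P≤ = nand-short P≤ (singleton-short k _)

  and-short : ∀ {k P Q} → Short k P → Short k Q → Short (2 + k) (andₚ P Q)
  and-short P≤ Q≤ = not-short (nand-short P≤ Q≤)

  or-short : ∀ {k P Q} → Short k P → Short k Q → Short (2 + k) (orₚ P Q)
  or-short P≤ Q≤ = nand-short (not-short P≤) (not-short Q≤)

  module _ {w k} {Ps : Fin w → Program n} {_∙_ : Program n → Program n → Program n} {ε : Program n}
           (ε-short : Short k ε)
           (∙-short : ∀ {l P Q} → Short l P → Short l Q → Short (2 + l) (P ∙ Q)) where

    -- With at most two inputs the fold nests at most two operations, and each of them costs two
    -- levels of `nandₚ`.
    fold-short : ∀ {is} → length is ≤ 2 → All (λ i → Short k (Ps i)) is →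
                 Short (4 + k) (foldr _∙_ ε (map Ps is))
    fold-short _ []        = Short-mono (ℕ.m≤n+m k 4) ε-short
    fold-short {i ∷ []} _ (P-short ∷ []) =
      Short-mono (ℕ.m≤n+m (2 + k) 2) (∙-short P-short ε-short)
    fold-short {i ∷ _} _ (P-short ∷ Q-short ∷ []) =
      ∙-short (Short-mono (ℕ.m≤n+m k 2) P-short) (∙-short Q-short ε-short)
    fold-short (s≤s (s≤s ())) (_ ∷ _ ∷ _ ∷ _)

  gate-short : ∀ {w k} (g : Gate w) {Ps : Fin w → Program n} → length (predecessors g) ≤ 2 →
               All (λ i → Short k (Ps i)) (predecessors g) → Short (4 + k) (gateₚ g Ps)
  gate-short {k = k} (NOT i) {Ps} _ (P-short ∷ []) =
    Short-mono (ℕ.m≤n+m (1 + k) 3) (not-short P-short)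
  gate-short {k = k} (AND is) = fold-short (singleton-short k _) and-short
  gate-short {k = k} (OR is)  = fold-short (singleton-short k _) or-short

  depth-bounds : ∀ {w} (d : Fin w → ℕ) is → All (λ i → d i ≤ foldr _⊔_ 0 (map d is)) is
  depth-bounds d []       = []
  depth-bounds d (i ∷ is) =
    ℕ.m≤m⊔n _ _ ∷ All.map (λ d≤ → ℕ.≤-trans d≤ (ℕ.m≤n⊔m _ _)) (depth-bounds d is)

  -- Each gate costs at most four levels of `nandₚ`. The factor 4 stands on the right so that
  -- `suc d * 4` reduces to `4 + d * 4`, the form that `gate-short` delivers.
  compile-short : ∀ {w} (W : Wiring n w) → maxFanIn W ≤ 2 → ∀ i →
                  Short (Vec.lookup (nodeDepths W) i * 4) (compile W i)
  compile-short inputs  _       i    = singleton-short _ _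
  compile-short (W ▷ g) fanIn≤2 zero =
    gate-short g (ℕ.m⊔n≤o⇒m≤o _ _ fanIn≤2)
      (All.map (λ {i} d≤ → Short-mono (ℕ.*-monoˡ-≤ 4 d≤)
                             (compile-short W (ℕ.m⊔n≤o⇒n≤o _ _ fanIn≤2) i))
        (depth-bounds (Vec.lookup (nodeDepths W)) (predecessors g)))
  compile-short (W ▷ g) fanIn≤2 (suc i) = compile-short W (ℕ.m⊔n≤o⇒n≤o _ _ fanIn≤2) i

  lookup≤maximum : ∀ {w} (ds : Vec ℕ w) i → Vec.lookup ds i ≤ Vec.foldr′ _⊔_ 0 ds
  lookup≤maximum (d ∷ ds) zero    = ℕ.m≤m⊔n _ _
  lookup≤maximum (d ∷ ds) (suc i) = ℕ.≤-trans (lookup≤maximum ds i) (ℕ.m≤n⊔m d _)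

  outputProgram : Circuit n 1 → Program n
  outputProgram C = compile (wiring C) (Vec.head (outputs C))

  outputProgram-computes : ∀ C → Computes (outputProgram C) (λ x → Vec.head (run C x))
  outputProgram-computes C with outputs C
  ... | o ∷ [] = compile-computes (wiring C) o

  outputProgram-length : ∀ C → fanIn C ≤ 2 → length (outputProgram C) ≤ 9 ^ (depth C * 4)
  outputProgram-length C fanIn≤2 = length≤
    (Short-mono (ℕ.*-monoˡ-≤ 4 (lookup≤maximum (nodeDepths (wiring C)) o))
      (compile-short (wiring C) fanIn≤2 o))
    where o = Vec.head (outputs C)

-- Words as data instances

Symbol : Set
Symbol = Letter ⊎ (State ⊎ State)

pattern letter a   = inj₁ a
pattern state s    = inj₂ (inj₁ s)
pattern nonState s = inj₂ (inj₂ s)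

-- Letters come first, so that the letters `0F` and `1F` have the names 0 and 1; the coding of a
-- test by three literals relies on this.
name : Symbol → AtomicConcept
name σ = toℕ (join 5 10 (Sum.map₂ (join 5 5) σ))

name-injective : ∀ σ τ → name σ ≡ name τ → σ ≡ τ
name-injective σ τ eq =
  trans (sym (decode-name σ)) (trans (cong decode (Fin.toℕ-injective eq)) (decode-name τ))
  where
  decode : Fin 15 → Symbol
  decode i = Sum.map₂ (splitAt 5) (splitAt 5 i)

  decode-name : ∀ σ → decode (join 5 10 (Sum.map₂ (join 5 5) σ)) ≡ σ
  decode-name σ rewrite Fin.splitAt-join 5 10 (Sum.map₂ (join 5 5) σ) with σ
  ... | letter a = refl
  ... | inj₂ τ   = cong inj₂ (Fin.splitAt-join 5 5 τ)

filler : AtomicConcept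
filler = 15

name≢filler : ∀ σ → name σ ≢ filler
name≢filler σ = ℕ.<⇒≢ (Fin.toℕ<n (join 5 10 (Sum.map₂ (join 5 5) σ)))

-- A second atom per instruction, (filler , pad a), equalises the lengths of the codes of 0F and 1F.
pad : Letter → ℕ
pad 0F      = 1
pad (suc _) = 0

pad≤1 : ∀ a → pad a ≤ 1
pad≤1 0F      = ℕ.≤-refl
pad≤1 (suc _) = z≤n

-- The padding atom comes directly before the letter atom, so that in the code the timestamp `pad a`
-- and the name of the letter are adjacent and all input-dependent bits of an instruction lie
-- together.
letterAtoms : ℕ → List Letter → List GroundAtom
letterAtoms j []      = []
letterAtoms j (a ∷ w) = (filler , + pad a) ∷ (name (letter a) , + j) ∷ letterAtoms (suc j) w

-- The filler at suc (length w) puts the end of the word into tem and makes the maximum positive.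
wordAtoms : List Letter → List GroundAtom
wordAtoms w = (name (state 0F) , 0ℤ) ∷ (filler , + suc (length w)) ∷ letterAtoms 0 w

letterAtoms-times : ∀ {M} j w → length w + j ≤ M → 1 ≤ M →
                    All (λ k → 0ℤ ℤ.≤ k × k ℤ.≤ + M) (map proj₂ (letterAtoms j w))
letterAtoms-times j []      _      _   = []
letterAtoms-times {M} j (a ∷ w) end≤M 1≤M =
  (+≤+ z≤n , +≤+ (ℕ.≤-trans (pad≤1 a) 1≤M)) ∷
  (+≤+ z≤n , +≤+ (ℕ.≤-trans (ℕ.m≤n+m j _) end≤M)) ∷
  letterAtoms-times (suc j) w (subst (_≤ M) (sym (ℕ.+-suc (length w) j)) end≤M) 1≤M

wordInstance : List Letter → DataInstance
wordInstance w = record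
  { atoms    = wordAtoms w
  ; min-is-0 = here refl , All.map proj₁ times
  ; max      = + suc (length w)
  ; max-is   = there (here refl) , All.map proj₂ times
  ; 1≤max    = +≤+ (s≤s z≤n)
  }
  where
  times : All (λ k → 0ℤ ℤ.≤ k × k ℤ.≤ + suc (length w)) (map proj₂ (wordAtoms w))
  times = (+≤+ z≤n , +≤+ z≤n) ∷ (+≤+ z≤n , ℤ.≤-refl) ∷
    letterAtoms-times 0 w (ℕ.m≤n⇒m≤1+n (ℕ.≤-reflexive (ℕ.+-identityʳ _))) (s≤s z≤n)

end : List Letter → ℤ
end w = + length w

end∈tem : ∀ w → end w ∈ tem (wordInstance w)
end∈tem w = +≤+ z≤n , +≤+ (ℕ.n≤1+n _)

TrueFacts : Interpretation → List GroundAtom → Set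
TrueFacts 𝔐 = All (λ (A , ℓ) → ℓ ∈ 𝔐 A)

-- E absorbs the violated transitions in the guesses of a krom model.
simulate : ∀ {𝔐 : Interpretation} {E : Set} {N} →
           (∀ j a s → j ℕ.< N → + j ∈ 𝔐 (name (letter a)) → + j ∈ 𝔐 (name (state s)) →
            E ⊎ + suc j ∈ 𝔐 (name (state (step s a)))) →
           ∀ j w s → length w + j ≤ N → TrueFacts 𝔐 (letterAtoms j w) →
           + j ∈ 𝔐 (name (state s)) →
           E ⊎ + (length w + j) ∈ 𝔐 (name (state (foldl step s w)))
simulate next j []      s _     _                         at-j = inj₂ at-j
simulate next j (a ∷ w) s end≤N (_ ∷ letter-at-j ∷ facts) at-j
  with next j a s (ℕ.≤-trans (s≤s (ℕ.m≤n+m j (length w))) end≤N) letter-at-j at-j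
... | inj₁ e = inj₁ e
... | inj₂ at-suc-j
  rewrite sym (ℕ.+-suc (length w) j) = simulate next (suc j) w (step s a) end≤N facts at-suc-j

-- The canonical model of a word

module _ (w : List Letter) where

  -- Off the word no letter is read, so the values there are unconstrained.
  stateAt : ℤ → State
  stateAt (+ j)    = foldl step 0F (List.take j w)
  stateAt -[1+ _ ] = 0F

  LetterAt : Letter → ℤ → Set
  LetterAt a (+ j)    = List.head (List.drop j w) ≡ just a
  LetterAt a -[1+ _ ] = ⊥

  Holds : Symbol → ℤ → Set
  Holds (letter a)   n = LetterAt a n
  Holds (state s)    n = stateAt n ≡ s
  Holds (nonState s) n = stateAt n ≢ s

  -- The universal quantifier makes every atomic concept that names no symbol, `filler` among them,
  -- true everywhere. On names of symbols it agrees with `Holds`, since `name` is injective.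
  canonical : Interpretation
  canonical A n = ∀ σ → name σ ≡ A → Holds σ n

  canonical⁺ : ∀ σ {n} → Holds σ n → n ∈ canonical (name σ)
  canonical⁺ σ {n} holds τ eq = subst (λ ρ → Holds ρ n) (sym (name-injective τ σ eq)) holds

  canonical⁻ : ∀ σ {n} → n ∈ canonical (name σ) → Holds σ n
  canonical⁻ σ holds = holds σ refl

take-step : ∀ {a} s w j → List.head (List.drop j w) ≡ just a →
            foldl step s (List.take (suc j) w) ≡ step (foldl step s (List.take j w)) a
take-step s (a ∷ w) zero    refl = refl
take-step s (b ∷ w) (suc j) eq   = take-step (step s b) w j eq

stateAt-next : ∀ w a n → LetterAt w a n → stateAt w (n ℤ.+ 1ℤ) ≡ step (stateAt w n) a
stateAt-next w a (+ j) eq rewrite ℕ.+-comm j 1 = take-step 0F w j eq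

stateAt-end : ∀ w → stateAt w (end w) ≡ foldl step 0F w
stateAt-end w = cong (foldl step 0F) (take-all (length w) w ℕ.≤-refl)

filler-true : ∀ w {n} → n ∈ canonical w filler
filler-true w σ eq = contradiction eq (name≢filler σ)

-- For the induction, `v` is the part of `w` that begins at instant `j`.
canonical-letters : ∀ w j v → (∀ i a → List.head (List.drop i v) ≡ just a → LetterAt w a (+ (i + j))) →
                    TrueFacts (canonical w) (letterAtoms j v)
canonical-letters w j []      _       = []
canonical-letters w j (a ∷ v) letters =
  filler-true w ∷ canonical⁺ w (letter a) (letters 0 a refl) ∷
  canonical-letters w (suc j) v
    (λ i b eq → subst (λ k → LetterAt w b (+ k)) (sym (ℕ.+-suc i j)) (letters (suc i) b eq))

canonical-facts : ∀ w → TrueFacts (canonical w) (wordAtoms w)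
canonical-facts w = canonical⁺ w (state 0F) refl ∷ filler-true w ∷
  canonical-letters w 0 w (λ i a eq → subst (λ k → LetterAt w a (+ k)) (sym (ℕ.+-identityʳ i)) eq)

-- The horn query

Recognises : ∀ {o c} → OMPIQ o c → Set₁
Recognises q = ∀ w → foldl step 0F w ≡ 1F ⇔ end w ∈ ans q (wordInstance w)

plain : Symbol → PrefixedAtom
plain σ = [] · name σ

symbol : Symbol → TemporalConcept
symbol σ = atom (name σ)

transition : Letter → State → Clause
transition a s =
  (plain (letter a) ∷ plain (state s) ∷ []) ⟶ [ ((○ , future) ∷ []) · name (state (step s a)) ]

hornOntology : Ontology
hornOntology = List.cartesianProductWith transition (List.allFin 5) (List.allFin 5)

transition∈ : ∀ a s → transition a s ∈ₗ hornOntology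
transition∈ a s = ∈-cartesianProductWith⁺ transition (∈-allFin a) (∈-allFin s)

all-transitions : ∀ {P : Clause → Set} → (∀ a s → P (transition a s)) → All P hornOntology
all-transitions holds =
  All.cartesianProductWith⁺ (setoid _) (setoid _) transition (List.allFin 5) (List.allFin 5)
    (λ {a} {s} _ _ → holds a s)

hornQuery : OMPIQ ○ horn
hornQuery = record
  { ontology = hornOntology
  ; inLTL    = record
    { operators = all-transitions λ _ _ → ([] ∷ [] ∷ []) , (refl ∷ []) ∷ []
    ; shape     = all-transitions λ _ _ → ℕ.≤-refl
    }
  ; concept  = symbol (state 1F)
  ; positive = atom _
  }

-- The clauses drive every model along the run. Conversely, the canonical model has exactly one
-- state at `end w`, the one that the run reaches.
hornQuery-recognises : Recognises hornQuery
hornQuery-recognises w = mk⇔ accept (λ (_ , certain) → reject certain)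
  where
  next : ∀ {𝔐} → All (TrueIn 𝔐) hornOntology → ∀ j a s →
         + j ∈ 𝔐 (name (letter a)) → + j ∈ 𝔐 (name (state s)) → + suc j ∈ 𝔐 (name (state (step s a)))
  next {𝔐} clauses j a s at-a at-s with All.lookup clauses (transition∈ a s) (+ j) (at-a ∷ at-s ∷ [])
  ... | here at-suc = subst (λ k → + k ∈ 𝔐 (name (state (step s a)))) (ℕ.+-comm j 1) at-suc

  accept : foldl step 0F w ≡ 1F → end w ∈ ans hornQuery (wordInstance w)
  accept accepting = end∈tem w , λ 𝔐 → λ where
    record { clauses = clauses ; facts = start ∷ _ ∷ letters } →
      subst₂ (λ s k → + k ∈ 𝔐 (name (state s))) accepting (ℕ.+-identityʳ (length w))
        -- No transition is violated in a model of the clauses, so the left alternative never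
        -- arises; `id` lets `E` be the conclusion itself.
        ([ id , id ]′ (simulate (λ j a s _ at-a at-s → inj₂ (next clauses j a s at-a at-s))
                        0 w 0F ℕ.≤-refl letters start))

  canonical-transitions : All (TrueIn (canonical w)) hornOntology
  canonical-transitions = all-transitions λ where
    a s n (at-a ∷ at-s ∷ []) → here (canonical⁺ w (state (step s a))
      (trans (stateAt-next w a n (canonical⁻ w (letter a) at-a))
             (cong (λ s → step s a) (canonical⁻ w (state s) at-s))))

  reject : (∀ 𝔐 → IsModel 𝔐 hornOntology (wordInstance w) → end w ∈ 𝔐 (name (state 1F))) →
           foldl step 0F w ≡ 1F
  reject certain = trans (sym (stateAt-end w)) (canonical⁻ w (state 1F)
    (certain (canonical w) record { clauses = canonical-transitions ; facts = canonical-facts w }))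

-- The krom queries

-- Both atoms may hold at once. This does no harm: the query concept is positive, so more true atoms
-- only make it easier to satisfy.
guess : State → Clause
guess s = [] ⟶ (plain (state s) ∷ plain (nonState s) ∷ [])

kromOntology : Ontology
kromOntology = map guess (List.allFin 5)

all-guesses : ∀ {P : Clause → Set} → (∀ s → P (guess s)) → All P kromOntology
all-guesses holds = All.map⁺ (All.universal holds (List.allFin 5))

-- Seen from `end w`, the strict `◇P` reaches every instant of the word, including the last one,
-- whose successor is `end w` itself.
error : Letter → State → TemporalConcept
error a s = ◇P (symbol (letter a) `∧ symbol (state s) `∧ ○F symbol (nonState (step s a)))

errors : List TemporalConcept
errors = List.cartesianProductWith error (List.allFin 5) (List.allFin 5)

all-errors : ∀ {P : TemporalConcept → Set} → (∀ a s → P (error a s)) → All P errors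
all-errors holds =
  All.cartesianProductWith⁺ (setoid _) (setoid _) error (List.allFin 5) (List.allFin 5)
    (λ {a} {s} _ _ → holds a s)

module _ (ϰ : TemporalConcept) where

  disjunction-positive : ∀ {ϰs} → All Positive ϰs → Positive ϰ → Positive (foldr _`∨_ ϰ ϰs)
  disjunction-positive []       p = p
  disjunction-positive (p ∷ ps) q = p `∨ disjunction-positive ps q

  module _ (𝔐 : Interpretation) {n : ℤ} where

    disjunction⁺ : ∀ {ϰ′ ϰs} → ϰ′ ∈ₗ ϰs → n ∈ ⟦ ϰ′ ⟧ 𝔐 → n ∈ ⟦ foldr _`∨_ ϰ ϰs ⟧ 𝔐
    disjunction⁺ (here refl) holds = inj₁ holds
    disjunction⁺ (there ∈ϰs) holds = inj₂ (disjunction⁺ ∈ϰs holds)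

    disjunction⁺-last : ∀ ϰs → n ∈ ⟦ ϰ ⟧ 𝔐 → n ∈ ⟦ foldr _`∨_ ϰ ϰs ⟧ 𝔐
    disjunction⁺-last []       holds = holds
    disjunction⁺-last (_ ∷ ϰs) holds = inj₂ (disjunction⁺-last ϰs holds)

    disjunction⁻ : ∀ {ϰs} → All (λ ϰ′ → ¬ (n ∈ ⟦ ϰ′ ⟧ 𝔐)) ϰs →
                   n ∈ ⟦ foldr _`∨_ ϰ ϰs ⟧ 𝔐 → n ∈ ⟦ ϰ ⟧ 𝔐
    disjunction⁻ []             holds        = holds
    disjunction⁻ (fails ∷ _)    (inj₁ holds) = contradiction holds fails
    disjunction⁻ (_ ∷ fail)     (inj₂ holds) = disjunction⁻ fail holds

kromConcept : TemporalConcept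
kromConcept = foldr _`∨_ (symbol (state 1F)) errors

kromQuery : ∀ o → OMPIQ o krom
kromQuery o = record
  { ontology = kromOntology
  ; inLTL    = record
    { operators = all-guesses λ _ → [] , ([] ∷ [] ∷ [])
    ; shape     = all-guesses λ _ → ℕ.≤-refl
    }
  ; concept  = kromConcept
  ; positive = disjunction-positive (symbol (state 1F))
      (all-errors λ _ _ → ◇P (atom _ `∧ atom _ `∧ ○F atom _)) (atom _)
  }

-- In any model either some guess contradicts a transition, which makes an `error` disjunct true, or
-- the guesses follow the run. The canonical model has no errors, so there only the accepting state
-- can satisfy the concept.
kromQuery-recognises : ∀ o → Recognises (kromQuery o)
kromQuery-recognises o w = mk⇔ accept (λ (_ , certain) → reject certain)
  where
  next : ∀ {𝔐} → All (TrueIn 𝔐) kromOntology → ∀ j a s → j ℕ.< length w →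
         + j ∈ 𝔐 (name (letter a)) → + j ∈ 𝔐 (name (state s)) →
         end w ∈ ⟦ kromConcept ⟧ 𝔐 ⊎ + suc j ∈ 𝔐 (name (state (step s a)))
  next {𝔐} clauses j a s j<N at-a at-s
    with All.lookup clauses (∈-map⁺ guess (∈-allFin (step s a))) (+ suc j) []
  ... | here at-suc         = inj₂ at-suc
  ... | there (here not-at) = inj₁ (disjunction⁺ (symbol (state 1F)) 𝔐
    (∈-cartesianProductWith⁺ error (∈-allFin a) (∈-allFin s))
    (+ j , +<+ j<N , at-a , at-s ,
      subst (λ k → + k ∈ 𝔐 (name (nonState (step s a)))) (ℕ.+-comm 1 j) not-at))

  accept : foldl step 0F w ≡ 1F → end w ∈ ans (kromQuery o) (wordInstance w)
  accept accepting = end∈tem w , λ 𝔐 → λ where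
    record { clauses = clauses ; facts = start ∷ _ ∷ letters } →
      [ id , (λ at-end → disjunction⁺-last (symbol (state 1F)) 𝔐 errors
        (subst₂ (λ s k → + k ∈ 𝔐 (name (state s))) accepting (ℕ.+-identityʳ (length w)) at-end)) ]′
        (simulate (next clauses) 0 w 0F (ℕ.≤-reflexive (ℕ.+-identityʳ _)) letters start)

  canonical-guesses : All (TrueIn (canonical w)) kromOntology
  canonical-guesses = all-guesses guesses
    where
    guesses : ∀ s → TrueIn (canonical w) (guess s)
    guesses s n _ with stateAt w n Fin.≟ s
    ... | yes at-s = here (canonical⁺ w (state s) at-s)
    ... | no ¬at-s = there (here (canonical⁺ w (nonState s) ¬at-s))

  no-errors : All (λ ϰ → ¬ (end w ∈ ⟦ ϰ ⟧ (canonical w))) errors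
  no-errors = all-errors λ where
    a s (n , _ , at-a , at-s , not-at) → canonical⁻ w (nonState (step s a)) not-at
      (trans (stateAt-next w a n (canonical⁻ w (letter a) at-a))
             (cong (λ s → step s a) (canonical⁻ w (state s) at-s)))

  reject : (∀ 𝔐 → IsModel 𝔐 kromOntology (wordInstance w) → end w ∈ ⟦ kromConcept ⟧ 𝔐) →
           foldl step 0F w ≡ 1F
  reject certain = trans (sym (stateAt-end w)) (canonical⁻ w (state 1F)
    (disjunction⁻ (symbol (state 1F)) (canonical w) no-errors
      (certain (canonical w) record { clauses = canonical-guesses ; facts = canonical-facts w })))

-- Injectivity of the encoding

-- A unary code ends at its first `false`, so it is prefix-free and can be stripped from the front
-- of any continuation.
unary-injective : ∀ m n {u v} → unary m ++ u ≡ unary n ++ v → m ≡ n × u ≡ v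
unary-injective zero    zero    refl = refl , refl
unary-injective (suc m) (suc n) eq   =
  let m≡n , u≡v = unary-injective m n (∷-injectiveʳ eq) in cong suc m≡n , u≡v

encodeAtoms : List GroundAtom → List Bool
encodeAtoms = List.concatMap (λ (A , k) → unary A ++ unary ∣ k ∣)

unary≢[] : ∀ m {u v : List Bool} → [] ≢ (unary m ++ u) ++ v
unary≢[] zero    ()
unary≢[] (suc m) ()

NonNegative : ℤ → Set
NonNegative k = 0ℤ ℤ.≤ k

∣∣-injective : ∀ {k l} → NonNegative k → NonNegative l → ∣ k ∣ ≡ ∣ l ∣ → k ≡ l
∣∣-injective (+≤+ _) (+≤+ _) = cong (λ n → + n)

encodeAtoms-injective : ∀ {as bs} →
  All (λ a → NonNegative (proj₂ a)) as → All (λ a → NonNegative (proj₂ a)) bs →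
  encodeAtoms as ≡ encodeAtoms bs → as ≡ bs
encodeAtoms-injective []        []       _  = refl
encodeAtoms-injective []        (_∷_ {A , _} _ _) eq = contradiction eq (unary≢[] A)
encodeAtoms-injective (_∷_ {A , _} _ _) [] eq = contradiction (sym eq) (unary≢[] A)
encodeAtoms-injective (_∷_ {A , k} {as} 0≤k 0≤as) (_∷_ {B , l} {bs} 0≤l 0≤bs) eq
  with refl , eq₁ ← unary-injective A B
         (trans (sym (++-assoc (unary A) (unary ∣ k ∣) (encodeAtoms as)))
                (trans eq (++-assoc (unary B) (unary ∣ l ∣) (encodeAtoms bs))))
  with ∣k∣≡∣l∣ , eq₂ ← unary-injective ∣ k ∣ ∣ l ∣ eq₁
  = cong₂ (λ k as → (A , k) ∷ as) (∣∣-injective 0≤k 0≤l ∣k∣≡∣l∣) (encodeAtoms-injective 0≤as 0≤bs eq₂)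

atoms-nonNegative : ∀ 𝒜 → All (λ a → NonNegative (proj₂ a)) (atoms 𝒜)
atoms-nonNegative 𝒜 = All.map⁻ (proj₂ (DataInstance.min-is-0 𝒜))

encode-injective : ∀ 𝒜 ℬ {k l} → NonNegative k → NonNegative l →
                   encode 𝒜 k ≡ encode ℬ l → atoms 𝒜 ≡ atoms ℬ × k ≡ l
encode-injective 𝒜 ℬ {k} {l} 0≤k 0≤l eq =
  let ∣k∣≡∣l∣ , eq′ = unary-injective ∣ k ∣ ∣ l ∣ eq
  in encodeAtoms-injective (atoms-nonNegative 𝒜) (atoms-nonNegative ℬ) eq′ ,
     ∣∣-injective 0≤k 0≤l ∣k∣≡∣l∣

-- `Answering` admits any instance with the given code. Injectivity forces its atoms and query
-- instant to be the intended ones, and being a model depends on the instance only through its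
-- atoms.
answering⇔ans : ∀ {o c} (q : OMPIQ o c) w →
                end w ∈ ans q (wordInstance w) ⇔ encode (wordInstance w) (end w) ∈ Answering q
answering⇔ans q w = mk⇔ (λ certain → wordInstance w , end w , refl , certain) decode
  where
  decode : encode (wordInstance w) (end w) ∈ Answering q → end w ∈ ans q (wordInstance w)
  decode (𝒜 , ℓ , eq , (0≤ℓ , _) , certain)
    with atoms≡ , refl ← encode-injective (wordInstance w) 𝒜 (+≤+ z≤n) 0≤ℓ eq
    = end∈tem w , λ 𝔐 model → certain 𝔐 record
        { clauses = IsModel.clauses model
        ; facts   = subst (TrueFacts 𝔐) atoms≡ (IsModel.facts model)
        }

-- Reduction circuits of depth one

data Literal (n : ℕ) : Set where
  fixed   : Bool → Literal n
  pos neg : Fin n → Literal n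

module _ {n : ℕ} where

  value : Vec Bool n → Literal n → Bool
  value x (fixed b) = b
  value x (pos i)   = Vec.lookup x i
  value x (neg i)   = not (Vec.lookup x i)

  -- Even a plain input gets a gate, a one-element `AND`, so that the outputs are exactly the first
  -- nodes. Gates refer to inputs only, past the `m` gates already placed.
  literalGate : ∀ m → Literal n → Gate (m + n)
  literalGate m (fixed true)  = AND []
  literalGate m (fixed false) = OR []
  literalGate m (pos i)       = AND [ m ↑ʳ i ]
  literalGate m (neg i)       = NOT (m ↑ʳ i)

  wire : ∀ {m} → Vec (Literal n) m → Wiring n (m + n)
  wire []                   = inputs
  wire {suc m} (l ∷ ls) = wire ls ▷ literalGate m l

  wire-values : ∀ {m} (ls : Vec (Literal n) m) x →
                values (wire ls) x ≡ Vec.map (value x) ls Vec.++ x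
  wire-values []       x = refl
  wire-values (l ∷ ls) x rewrite wire-values ls x = cong (_∷ _) (gate-value l)
    where
    gate-value : ∀ l → evalGate (Vec.map (value x) ls Vec.++ x) (literalGate _ l) ≡ value x l
    gate-value (fixed true)  = refl
    gate-value (fixed false) = refl
    gate-value (pos i)       =
      trans (∧-identityʳ _) (Vec.lookup-++ʳ (Vec.map (value x) ls) x i)
    gate-value (neg i)       = cong not (Vec.lookup-++ʳ (Vec.map (value x) ls) x i)

  wire-depths : ∀ {m} (ls : Vec (Literal n) m) →
                nodeDepths (wire ls) ≡ Vec.replicate m 1 Vec.++ Vec.replicate n 0
  wire-depths []           = refl
  wire-depths {suc m} (l ∷ ls) rewrite wire-depths ls = cong (_∷ depths) (gate-depth l)
    where
    depths = Vec.replicate m 1 Vec.++ Vec.replicate n 0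

    input-depth : ∀ i → Vec.lookup depths (m ↑ʳ i) ≡ 0
    input-depth i =
      trans (Vec.lookup-++ʳ (Vec.replicate m 1) (Vec.replicate n 0) i) (Vec.lookup-replicate i 0)

    gate-depth : ∀ l →
      suc (foldr _⊔_ 0 (map (Vec.lookup depths) (predecessors (literalGate m l)))) ≡ 1
    gate-depth (fixed true)  = refl
    gate-depth (fixed false) = refl
    gate-depth (pos i) rewrite input-depth i = refl
    gate-depth (neg i) rewrite input-depth i = refl

  literalCircuit : ∀ ls → Circuit n (length ls)
  literalCircuit ls = record
    { wiring  = wire (Vec.fromList ls)
    ; outputs = Vec.tabulate (_↑ˡ n)
    }

  literalCircuit-run : ∀ ls x → Vec.toList (run (literalCircuit ls) x) ≡ map (value x) ls
  literalCircuit-run ls x = begin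
    Vec.toList (run (literalCircuit ls) x)
      ≡⟨ cong Vec.toList (sym (Vec.tabulate-∘ _ _)) ⟩
    Vec.toList (Vec.tabulate (λ i → Vec.lookup (values (wire v) x) (i ↑ˡ n)))
      ≡⟨ cong Vec.toList (Vec.tabulate-cong λ i → cong (λ u → Vec.lookup u (i ↑ˡ n)) (wire-values v x)) ⟩
    Vec.toList (Vec.tabulate (λ i → Vec.lookup (Vec.map (value x) v Vec.++ x) (i ↑ˡ n)))
      ≡⟨ cong Vec.toList (Vec.tabulate-cong (Vec.lookup-++ˡ (Vec.map (value x) v) x)) ⟩
    Vec.toList (Vec.tabulate (Vec.lookup (Vec.map (value x) v)))
      ≡⟨ cong Vec.toList (Vec.tabulate∘lookup _) ⟩
    Vec.toList (Vec.map (value x) v)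
      ≡⟨ Vec.toList-map (value x) v ⟩
    map (value x) (Vec.toList v)
      ≡⟨ cong (map (value x)) (Vec.toList∘fromList ls) ⟩
    map (value x) ls ∎
    where
    open ≡-Reasoning
    v = Vec.fromList ls

  literalCircuit-depth : ∀ ls → depth (literalCircuit ls) ≤ 1
  literalCircuit-depth ls rewrite wire-depths (Vec.fromList ls) = ones (length ls)
    where
    zeros : ∀ k → Vec.foldr′ _⊔_ 0 (Vec.replicate k 0) ≤ 1
    zeros zero    = z≤n
    zeros (suc k) = zeros k

    ones : ∀ m → Vec.foldr′ _⊔_ 0 (Vec.replicate m 1 Vec.++ Vec.replicate n 0) ≤ 1
    ones zero    = zeros n
    ones (suc m) = ℕ.⊔-lub ℕ.≤-refl (ones m)

  constants : List Bool → List (Literal n)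
  constants = map fixed

  constants-values : ∀ x bs → map (value x) (constants bs) ≡ bs
  constants-values x bs = trans (sym (map-∘ bs)) (map-id bs)

  -- The three middle literals of a test spell unary (pad a) ++ unary (name (letter a)) for the
  -- letter a selected by the bit: false, true, false for 1F and true, false, false for 0F.
  instructionLiterals : ℕ → Instruction n → List (Literal n)
  instructionLiterals j (const a) =
    constants ((unary filler ++ unary (pad a)) ++ unary (name (letter a)) ++ unary j)
  instructionLiterals j (test i)  =
    constants (unary filler) ++ neg i ∷ pos i ∷ fixed false ∷ constants (unary j)

  blockLiterals : ℕ → Program n → List (Literal n)
  blockLiterals j []      = []
  blockLiterals j (i ∷ P) = instructionLiterals j i ++ blockLiterals (suc j) P

  -- The code of the query instant and of the first two atoms of `wordAtoms`; it depends on the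
  -- length of the program but not on the input.
  header : ℕ → List Bool
  header N = unary N ++ (unary (name (state 0F)) ++ unary 0) ++ (unary filler ++ unary (suc N))

  programLiterals : Program n → List (Literal n)
  programLiterals P = constants (header (length P)) ++ blockLiterals 0 P

  instruction-values : ∀ x j i → let a = read x i in
    map (value x) (instructionLiterals j i) ≡
    (unary filler ++ unary (pad a)) ++ unary (name (letter a)) ++ unary j
  instruction-values x j (const a) = constants-values x _
  instruction-values x j (test i)
    rewrite constants-values x (unary j) with Vec.lookup x i
  ... | true  = refl
  ... | false = refl

  block-values : ∀ x j P →
    map (value x) (blockLiterals j P) ≡ encodeAtoms (letterAtoms j (word P x))
  block-values x j []      = refl
  block-values x j (i ∷ P)
    rewrite map-++ (value x) (instructionLiterals j i) (blockLiterals (suc j) P)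
          | instruction-values x j i
          | block-values x (suc j) P
    = ++-assoc (unary filler ++ unary (pad a)) (unary (name (letter a)) ++ unary j) _
    where a = read x i

  program-values : ∀ x P → let w = word P x in
    map (value x) (programLiterals P) ≡ encode (wordInstance w) (end w)
  program-values x P
    rewrite map-++ (value x) (constants (header (length P))) (blockLiterals 0 P)
          | constants-values x (header (length P))
          | block-values x 0 P
          | length-map (read x) P
    = trans (++-assoc (unary N) _ _)
        (cong (unary N ++_) (++-assoc (unary (name (state 0F)) ++ unary 0) (unary filler ++ unary (suc N)) _))
    where N = length P

  length-unary : ∀ k → length (unary k) ≡ suc k
  length-unary zero    = refl
  length-unary (suc k) = cong suc (length-unary k)

  length-constants : ∀ bs → length (constants bs) ≡ length bs
  length-constants = length-map fixed

  letter-name≤4 : ∀ a → name (letter a) ≤ 4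
  letter-name≤4 a rewrite Fin.toℕ-↑ˡ a 10 = ℕ.≤-pred (Fin.toℕ<n a)

  -- The padding atom takes at most 16 + 2 bits, the name of the letter at most 5 and the instant
  -- `suc j`, which sums to `24 + j`.
  instruction-length : ∀ j i → length (instructionLiterals j i) ≤ 24 + j
  instruction-length j (const a)
    rewrite length-constants ((unary filler ++ unary (pad a)) ++ unary (name (letter a)) ++ unary j)
          | length-++ (unary filler ++ unary (pad a)) {unary (name (letter a)) ++ unary j}
          | length-++ (unary filler) {unary (pad a)}
          | length-++ (unary (name (letter a))) {unary j}
          | length-unary (pad a)
          | length-unary (name (letter a))
          | length-unary j
    = ℕ.+-mono-≤ {16 + suc (pad a)} {18} (ℕ.+-monoʳ-≤ 16 (s≤s (pad≤1 a)))
        (ℕ.+-monoˡ-≤ (suc j) (s≤s (letter-name≤4 a)))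
  instruction-length j (test i)
    rewrite length-constants (unary j) | length-unary j = ℕ.m≤n+m (20 + j) 4

  block-length : ∀ j P → length (blockLiterals j P) ≤ length P * (24 + (length P + j))
  block-length j []      = z≤n
  block-length j (i ∷ P)
    rewrite length-++ (instructionLiterals j i) {blockLiterals (suc j) P}
    = ℕ.+-mono-≤
        (ℕ.≤-trans (instruction-length j i) (ℕ.+-monoʳ-≤ 24 (ℕ.m≤n+m j (suc (length P)))))
        (subst (λ k → length (blockLiterals (suc j) P) ≤ length P * (24 + k))
          (ℕ.+-suc (length P) j) (block-length (suc j) P))

  program-length : ∀ P → let N = length P in length (programLiterals P) ≤ 26 + (N + N) + N * (24 + N)
  program-length P
    rewrite length-++ (constants (header (length P))) {blockLiterals 0 P}
          | length-constants (header (length P))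
          | length-++ (unary (length P))
              {(unary (name (state 0F)) ++ unary 0) ++ (unary filler ++ unary (suc (length P)))}
          | length-unary (length P)
    = ℕ.+-mono-≤ (ℕ.≤-reflexive (arithmetic (length P)))
        (subst (λ k → length (blockLiterals 0 P) ≤ length P * (24 + k))
          (ℕ.+-identityʳ (length P)) (block-length 0 P))
    where
    -- 23 = 6 + 1 + 16 counts the codes of `name (state 0F)`, of 0 and of `filler`.
    arithmetic : ∀ N → suc (N + (23 + suc (suc N))) ≡ 26 + (N + N)
    arithmetic = solve-∀

-- Polynomial bounds

-- Unlike n ^ c + c, the bound (2 + n) ^ k is closed under sums and products.
Poly : (ℕ → ℕ) → Set
Poly f = ∃[ k ] ∀ n → f n ≤ (2 + n) ^ k

1≤[2+n]^ : ∀ n k → 1 ≤ (2 + n) ^ k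
1≤[2+n]^ n k = ℕ.m^n>0 (2 + n) k

double : ∀ n m → m + m ≤ (2 + n) * m
double n m = ℕ.≤-trans (ℕ.≤-reflexive (cong (m ℕ.+_) (sym (ℕ.+-identityʳ m)))) (ℕ.*-monoˡ-≤ m (ℕ.m≤m+n 2 n))

module _ {f g : ℕ → ℕ} where

  Poly-≤ : (∀ n → f n ≤ g n) → Poly g → Poly f
  Poly-≤ f≤g (k , g≤) = k , λ n → ℕ.≤-trans (f≤g n) (g≤ n)

  Poly-* : Poly f → Poly g → Poly (λ n → f n * g n)
  Poly-* (k , f≤) (l , g≤) = k + l , λ n →
    ℕ.≤-trans (ℕ.*-mono-≤ (f≤ n) (g≤ n)) (ℕ.≤-reflexive (sym (ℕ.^-distribˡ-+-* (2 + n) k l)))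

  -- Both summands lie below `(2 + n) ^ (k + l)`, and one further factor of a base that is at least
  -- 2 absorbs the doubling.
  Poly-+ : Poly f → Poly g → Poly (λ n → f n + g n)
  Poly-+ (k , f≤) (l , g≤) = suc (k + l) , λ n → ℕ.≤-trans
    (ℕ.+-mono-≤ (ℕ.≤-trans (f≤ n) (ℕ.^-monoʳ-≤ (2 + n) (ℕ.m≤m+n k l)))
                (ℕ.≤-trans (g≤ n) (ℕ.^-monoʳ-≤ (2 + n) (ℕ.m≤n+m l k))))
    (double n ((2 + n) ^ (k + l)))

Poly-const : ∀ c → Poly (λ _ → c)
Poly-const c = c , bound c
  where
  bound : ∀ c n → c ≤ (2 + n) ^ c
  bound zero    n = z≤n
  bound (suc c) n = ℕ.≤-trans (ℕ.+-mono-≤ (1≤[2+n]^ n c) (bound c n)) (double n ((2 + n) ^ c))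

Poly-id : Poly id
Poly-id = 1 , λ n → ℕ.≤-trans (ℕ.m≤n+m n 2) (ℕ.≤-reflexive (sym (ℕ.^-identityʳ (2 + n))))

-- For n at least 2 the base `2 + n` is at most `n ^ 2`, which doubles the exponent; for n at most 1
-- it is at most 3, and the additive `3 ^ k` suffices.
Poly⇒PolynomiallyBounded : ∀ {f} → Poly f → PolynomiallyBounded f
Poly⇒PolynomiallyBounded {f} (k , f≤) = 2 * k + 3 ^ k , bound
  where
  c = 2 * k + 3 ^ k

  small : ∀ n → 2 + n ≤ 3 → f n ≤ n ^ c + c
  small n n≤1 = ℕ.≤-trans (f≤ n) (ℕ.≤-trans (ℕ.^-monoˡ-≤ k n≤1)
    (ℕ.≤-trans (ℕ.m≤n+m (3 ^ k) (2 * k)) (ℕ.m≤n+m c (n ^ c))))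

  square : ∀ m → 4 + m ≤ (2 + m) ^ 2
  square m = ℕ.≤-trans (ℕ.m≤m+n (4 + m) (3 * m + m * m)) (ℕ.≤-reflexive (arithmetic m))
    where
    arithmetic : ∀ m → 4 + m + (3 * m + m * m) ≡ (2 + m) * ((2 + m) * 1)
    arithmetic = solve-∀

  bound : ∀ n → f n ≤ n ^ c + c
  bound 0               = small 0 (ℕ.n≤1+n 2)
  bound 1               = small 1 ℕ.≤-refl
  bound n@(suc (suc m)) = begin
    f n            ≤⟨ f≤ n ⟩
    (2 + n) ^ k    ≤⟨ ℕ.^-monoˡ-≤ k (square m) ⟩
    (n ^ 2) ^ k    ≡⟨ ℕ.^-*-assoc n 2 k ⟩
    n ^ (2 * k)    ≤⟨ ℕ.^-monoʳ-≤ n (ℕ.m≤m+n (2 * k) (3 ^ k)) ⟩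
    n ^ c          ≤⟨ ℕ.m≤m+n (n ^ c) c ⟩
    n ^ c + c      ∎
    where open ℕ.≤-Reasoning

-- Reduces a bound on `2 ^ ⌈log₂ n ⌉` to monotonicity of the logarithm and its value at a power of
-- two. The summand 1 accommodates n = 0.
nearby-power : ∀ n → ∃[ k ] n ≤ 2 ^ k × 2 ^ k ≤ 1 + 2 * n
nearby-power zero    = 0 , z≤n , ℕ.≤-refl
nearby-power (suc n) with k , n≤2^k , 2^k≤ ← nearby-power n with suc n ℕ.≤? 2 ^ k
... | yes n<2^k = k , n<2^k , ℕ.≤-trans 2^k≤ (s≤s (ℕ.*-monoʳ-≤ 2 (ℕ.n≤1+n n)))
... | no  n≮2^k = suc k , upper , lower
  where
  2^k≤n : 2 ^ k ≤ n
  2^k≤n = ℕ.≮⇒≥ n≮2^k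

  upper : suc n ≤ 2 * 2 ^ k
  upper = ℕ.≤-trans (ℕ.+-mono-≤ (ℕ.m^n>0 2 k) n≤2^k)
    (ℕ.≤-reflexive (cong (2 ^ k ℕ.+_) (sym (ℕ.+-identityʳ (2 ^ k)))))

  lower : 2 * 2 ^ k ≤ 1 + 2 * suc n
  lower = ℕ.m≤n⇒m≤1+n (ℕ.*-monoʳ-≤ 2 (ℕ.m≤n⇒m≤1+n 2^k≤n))

2^⌈log₂⌉ : ∀ n → 2 ^ ⌈log₂ n ⌉ ≤ 1 + 2 * n
2^⌈log₂⌉ n with k , n≤2^k , 2^k≤ ← nearby-power n = ℕ.≤-trans
  (ℕ.^-monoʳ-≤ 2 (ℕ.≤-trans (⌈log₂⌉-mono-≤ n≤2^k) (ℕ.≤-reflexive (⌈log₂2^n⌉≡n k)))) 2^k≤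

-- Replacing 9 by 16 = `2 ^ 4` turns the expression into a fixed power of `2 ^ suc ⌈log₂ n ⌉`, which
-- is at most linear in n.
Poly-9^depth : ∀ {d} → LogarithmicallyBounded d → Poly (λ n → 9 ^ (d n * 4))
Poly-9^depth {d} (c , d≤) = 2 * (16 * c) , λ n → begin
  9 ^ (d n * 4)                        ≤⟨ ℕ.^-monoʳ-≤ 9 (ℕ.*-monoˡ-≤ 4 (d≤ n)) ⟩
  9 ^ ((c * ⌈log₂ n ⌉ + c) * 4)        ≤⟨ ℕ.^-monoˡ-≤ ((c * ⌈log₂ n ⌉ + c) * 4) (ℕ.m≤m+n 9 7) ⟩
  (2 ^ 4) ^ ((c * ⌈log₂ n ⌉ + c) * 4)  ≡⟨ ℕ.^-*-assoc 2 4 ((c * ⌈log₂ n ⌉ + c) * 4) ⟩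
  2 ^ (4 * ((c * ⌈log₂ n ⌉ + c) * 4))  ≡⟨ cong (2 ^_) (exponent c ⌈log₂ n ⌉) ⟩
  2 ^ (suc ⌈log₂ n ⌉ * (16 * c))       ≡⟨ ℕ.^-*-assoc 2 (suc ⌈log₂ n ⌉) (16 * c) ⟨
  (2 * 2 ^ ⌈log₂ n ⌉) ^ (16 * c)       ≤⟨ ℕ.^-monoˡ-≤ (16 * c) (square n) ⟩
  ((2 + n) ^ 2) ^ (16 * c)             ≡⟨ ℕ.^-*-assoc (2 + n) 2 (16 * c) ⟩
  (2 + n) ^ (2 * (16 * c))             ∎
  where
  open ℕ.≤-Reasoning

  exponent : ∀ c l → 4 * ((c * l + c) * 4) ≡ suc l * (16 * c)
  exponent = solve-∀

  arithmetic : ∀ n → 2 * (1 + 2 * n) + (2 + n * n) ≡ (2 + n) * ((2 + n) * 1)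
  arithmetic = solve-∀

  square : ∀ n → 2 * 2 ^ ⌈log₂ n ⌉ ≤ (2 + n) ^ 2
  square n = ℕ.≤-trans (ℕ.*-monoʳ-≤ 2 (2^⌈log₂⌉ n))
    (ℕ.≤-trans (ℕ.m≤m+n _ (2 + n * n)) (ℕ.≤-reflexive (arithmetic n)))

-- Assembling the reduction

-- For each input length the reduction writes out the data instance of the compiled program; the
-- query enters through `recognises` alone.
recognises⇒hard : ∀ {o c} (q : OMPIQ o c) → Recognises q → NC¹-Hard (Answering q)
recognises⇒hard q recognises L L∈NC¹ = record
  { outLength  = λ n → length (literals n)
  ; circuit    = λ n → literalCircuit (literals n)
  -- The summands count the gates, the inputs and the outputs.
  ; polySize   = Poly⇒PolynomiallyBounded (Poly-+ (Poly-+ literals-poly Poly-id) literals-poly)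
  ; constDepth = 1 , λ n → literalCircuit-depth (literals n)
  ; reduces    = λ x → mk⇔ (sound x) (complete x)
  }
  where
  open NC¹ L∈NC¹
  open Equivalence

  program : ∀ n → Program n
  program n = outputProgram (circuit n)

  literals : ∀ n → List (Literal n)
  literals n = programLiterals (program n)

  program-poly : Poly (λ n → length (program n))
  program-poly = Poly-≤ (λ n → outputProgram-length (circuit n) (fanIn≤2 n)) (Poly-9^depth logDepth)

  literals-poly : Poly (λ n → length (literals n))
  literals-poly = Poly-≤ (λ n → program-length (program n))
    (Poly-+ (Poly-+ (Poly-const 26) (Poly-+ program-poly program-poly))
            (Poly-* program-poly (Poly-+ (Poly-const 24) program-poly)))

  module _ {n} (x : Vec Bool n) where

    w : List Letter
    w = word (program n) x

    final-state : foldl step 0F w ≡ step 0F (bit (Vec.head (run (circuit n) x)))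
    final-state = action (outputProgram-computes (circuit n)) x 0F

    -- The identity fixes 0, so arriving at 1 rules out `false`.
    accepting⇒true : ∀ b → step 0F (bit b) ≡ 1F → b ≡ true
    accepting⇒true true _ = refl

    output : Vec.toList (run (literalCircuit (literals n)) x) ≡ encode (wordInstance w) (end w)
    output = trans (literalCircuit-run (literals n) x) (program-values x (program n))

    sound : Vec.toList x ∈ L → Vec.toList (run (literalCircuit (literals n)) x) ∈ Answering q
    sound x∈L = subst (_∈ Answering q) (sym output)
      (to (answering⇔ans q w) (to (recognises w)
        (trans final-state (cong (λ b → step 0F (bit b)) (to (decides x) x∈L)))))

    complete : Vec.toList (run (literalCircuit (literals n)) x) ∈ Answering q → Vec.toList x ∈ L
    complete accepted = from (decides x) (accepting⇒true _
      (trans (sym final-state)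
        (from (recognises w) (from (answering⇔ans q w) (subst (_∈ Answering q) output accepted)))))

theorem10 : (Σ (OMPIQ ○ horn) λ q → IsOMAQ q × NC¹-Hard (Answering q))
    × (Σ (OMPIQ □ krom) λ q → NC¹-Hard (Answering q))
    × (Σ (OMPIQ ○ krom) λ q → NC¹-Hard (Answering q))
theorem10 =
    (hornQuery , (_ , refl) , recognises⇒hard hornQuery hornQuery-recognises)
  , (kromQuery □ , recognises⇒hard (kromQuery □) (kromQuery-recognises □))
  , (kromQuery ○ , recognises⇒hard (kromQuery ○) (kromQuery-recognises ○))
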